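{- The concept satisfiability problem for $\mathcal{ALCO}_{\mathsf{vpl}}$ is undecidable. This holds even if the languages allowed in concepts are restricted to $\{r\}$, $\{s\}$, $r^+$, $s^+$, $r^*$, $s^*$, $(r+s)^*$, $(r+s)^+$ and $r^{\#}s^{\#}:=\{r^ns^n\mid n\in\mathbb{N}\}$, for a fixed call role name $r$ and a fixed return role name $s$.
   Context: Fix countably infinite pairwise disjoint sets of individual names, concept names and role names. An interpretation $\mathcal{I}=(\Delta^{\mathcal{I}},\cdot^{\mathcal{I}})$ consists of a non-empty domain together with a map sending individual names to elements, concept names to subsets and role names to binary relations on $\Delta^{\mathcal{I}}$. The role names are partitioned into call, internal and return role names. The pushdown alphabet $\Sigma_{\mathsf{vpl}}$ has: - call letters: the call role names; - internal letters: the internal role names together with tests $A?$ for concept names $A$; - return letters: the return role names. A visibly pushdown automaton (VPA) is a nondeterministic pushdown automaton over such an alphabet with the following stack discipline: it pushes exactly one stack symbol on a call letter; it leaves the stack unchanged on an internal letter; it pops the top symbol on a return letter, or, if the stack is empty (only the bottom symbol), leaves it unchanged. Acceptance is by final state. A VPL is a language accepted by a VPA. For a language $L$ of words whose letters are role names or tests $A?$, an element $e$ is $L$-reachable from $d$ in $\mathcal{I}$ if there exist elements $\rho_1,\dots,\rho_{n+1}$ with $\rho_1=d$ and $\rho_{n+1}=e$, and a word $w_1\cdots w_n\in L$, such that for each $i$ one of the following holds: - $w_i$ is a role name and $(\rho_i,\rho_{i+1})\in w_i^{\mathcal{I}}$; or - $w_i=A?$ and $\rho_i=\rho_{i+1}\in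 A^{\mathcal{I}}$. $\mathcal{ALCO}_{\mathsf{vpl}}$-concepts are given by the grammar $C::=\top\mid A\mid\{a\}\mid\neg C\mid C\sqcap C\mid\exists L.C$, where $A$ is a concept name, $a$ is an individual name, and $L$ is a VPL over a finite subset of $\Sigma_{\mathsf{vpl}}$ given by a VPA. The semantics are as follows: - $\{a\}^{\mathcal{I}}=\{a^{\mathcal{I}}\}$; - $(\exists L.C)^{\mathcal{I}}$ is the set of elements that can $L$-reach an element of $C^{\mathcal{I}}$; - the Boolean constructors have the usual semantics. A concept $C$ is satisfiable if $C^{\mathcal{I}}\neq\emptyset$ for some interpretation $\mathcal{I}$. $\mathbb{N}$ includes $0$. -}

module Defs where

open import Level using (Level)
open import Data.Nat using (ℕ; zero; suc; _≤_)
open import Data.Fin using (Fin; zero; suc)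
open import Data.Bool using (Bool; true)
open import Data.Maybe using (Maybe; just; nothing; _>>=_)
open import Data.List using (List; []; _∷_; _++_; replicate; length)
open import Data.List.Relation.Unary.All using (All)
open import Data.List.Membership.Propositional using (_∈_)
open import Data.Product using (Σ; _×_; _,_)
open import Data.Sum using (_⊎_)
open import Relation.Nullary using (¬_)
open import Relation.Binary.PropositionalEquality using (_≡_)
open import Function.Bundles using (_⇔_)

-- Names.  Individual names, concept names and role names are each a
-- copy of ℕ (countably infinite, pairwise disjoint by typing).  Role
-- names are partitioned into call, internal and return role names.

data RoleName : Set where
  call : ℕ → RoleName
  int  : ℕ → RoleName
  ret  : ℕ → RoleName

-- Letters of words: role names or tests A? (A a concept name).
data Letter : Set where
  role : RoleName → Letter
  test : ℕ → Letter

Word : Set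
Word = List Letter

record Interp : Set₁ where
  field
    Δ   : Set
    elt : Δ                          -- non-empty domain
    ind : ℕ → Δ
    con : ℕ → Δ → Set
    rol : RoleName → Δ → Δ → Set

open Interp public

data Path (I : Interp) : Δ I → Word → Δ I → Set where
  nil   : ∀ {d} → Path I d [] d
  stepR : ∀ {d d' e ρ w} → rol I ρ d d' → Path I d' w e → Path I d (role ρ ∷ w) e
  stepT : ∀ {d e A w} → con I A d → Path I d w e → Path I d (test A ∷ w) e

data Concept (Lang : Set) : Set where
  ⊤c  : Concept Lang
  atom : ℕ → Concept Lang
  nom  : ℕ → Concept Lang
  neg  : Concept Lang → Concept Lang
  and  : Concept Lang → Concept Lang → Concept Lang
  ex   : Lang → Concept Lang → Concept Lang

module _ {Lang : Set} (⟦_⟧L : Lang → Word → Set) (I : Interp) where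
  ⟦_⟧ : Concept Lang → Δ I → Set
  ⟦ ⊤c ⟧ d = Data.Unit.⊤ where import Data.Unit
  ⟦ atom A ⟧ d = con I A d
  ⟦ nom a ⟧ d = d ≡ ind I a
  ⟦ neg C ⟧ d = ¬ ⟦ C ⟧ d
  ⟦ and C D ⟧ d = ⟦ C ⟧ d × ⟦ D ⟧ d
  ⟦ ex L C ⟧ d = Σ (Δ I) λ e → Σ Word λ w → ⟦ L ⟧L w × Path I d w e × ⟦ C ⟧ e

Satisfiable : {Lang : Set} → (Lang → Word → Set) → Concept Lang → Set₁
Satisfiable ⟦_⟧L C = Σ Interp λ I → Σ (Δ I) λ d → ⟦_⟧ ⟦_⟧L I C d

-- Visibly pushdown automata over Σ_vpl (finite presentation).
-- The finite subset of Σ_vpl used is the set of letters occurring in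
-- the (finite) transition lists.

data ILetter : Set where
  irole : ℕ → ILetter
  itest : ℕ → ILetter

iletter : ILetter → Letter
iletter (irole i) = role (int i)
iletter (itest A) = test A

record VPA : Set where
  field
    nQ    : ℕ
    nΓ    : ℕ                                   -- stack symbols Fin nΓ (plus bottom)
    init  : Fin nQ
    final : List (Fin nQ)
    callT : List (Fin nQ × ℕ × Fin nQ × Fin nΓ)
    intT  : List (Fin nQ × ILetter × Fin nQ)
    retT  : List (Fin nQ × ℕ × Maybe (Fin nΓ) × Fin nQ)   -- (q, return c, pop γ / bottom, q')

module _ (A : VPA) where
  open VPA A
  -- Run q σ w f : from state q with stack σ (above bottom), reading w, can end in f
  data Run : Fin nQ → List (Fin nΓ) → Word → Fin nQ → Set where
    done  : ∀ {q σ} → Run q σ [] q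
    callS : ∀ {q c q' γ σ w f} → (q , c , q' , γ) ∈ callT →
            Run q' (γ ∷ σ) w f → Run q σ (role (call c) ∷ w) f
    intS  : ∀ {q a q' σ w f} → (q , a , q') ∈ intT →
            Run q' σ w f → Run q σ (iletter a ∷ w) f
    retS  : ∀ {q c γ q' σ w f} → (q , c , just γ , q') ∈ retT →
            Run q' σ w f → Run q (γ ∷ σ) (role (ret c) ∷ w) f
    retB  : ∀ {q c q' w f} → (q , c , nothing , q') ∈ retT →
            Run q' [] w f → Run q [] (role (ret c) ∷ w) f

  Accepts : Word → Set
  Accepts w = Σ (Fin nQ) λ f → (f ∈ final) × Run init [] w f

ConceptVPL : Set
ConceptVPL = Concept VPA

SatVPL : ConceptVPL → Set₁
SatVPL = Satisfiable Accepts

data RLang : Set where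
  oneR oneS rPlus sPlus rStar sStar rsStar rsPlus rnsn : RLang

module _ (r s : ℕ) where
  private
    R S : Letter
    R = role (call r)
    S = role (ret s)
    RorS : Letter → Set
    RorS x = (x ≡ R) ⊎ (x ≡ S)

  ⟦_⟧R : RLang → Word → Set
  ⟦ oneR ⟧R w = w ≡ R ∷ []
  ⟦ oneS ⟧R w = w ≡ S ∷ []
  ⟦ rPlus ⟧R w = All (_≡ R) w × 1 ≤ length w
  ⟦ sPlus ⟧R w = All (_≡ S) w × 1 ≤ length w
  ⟦ rStar ⟧R w = All (_≡ R) w
  ⟦ sStar ⟧R w = All (_≡ S) w
  ⟦ rsStar ⟧R w = All RorS w
  ⟦ rsPlus ⟧R w = All RorS w × 1 ≤ length w
  ⟦ rnsn ⟧R w = Σ ℕ λ n → w ≡ replicate n R ++ replicate n S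

SatR : (r s : ℕ) → Concept RLang → Set₁
SatR r s = Satisfiable (⟦_⟧R r s)

-- Synthetic (un)decidability.  A predicate is decidable if some (Agda,
-- hence computable) Boolean function decides it.  A predicate is
-- undecidable if its decidability would make the halting problem of
-- two-counter (Minsky) machines decidable.

Decidable : ∀ {a ℓ} {X : Set a} → (X → Set ℓ) → Set _
Decidable {X = X} P = Σ (X → Bool) λ f → ∀ x → P x ⇔ (f x ≡ true)

data Instr : Set where
  inc : Fin 2 → ℕ → Instr
  dec : Fin 2 → ℕ → ℕ → Instr      -- if counter = 0 goto k else decrement, goto j

Program : Set
Program = List Instr

Config : Set
Config = ℕ × ℕ × ℕ                   -- program counter, counter 0, counter 1

nth : List Instr → ℕ → Maybe Instr
nth [] _ = nothing
nth (x ∷ xs) zero = just x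
nth (x ∷ xs) (suc n) = nth xs n

-- one step; nothing = halted (program counter out of range)
step : Program → Config → Maybe Config
step P (pc , a , b) with nth P pc
... | nothing = nothing
... | just (inc zero j) = just (j , suc a , b)
... | just (inc (suc _) j) = just (j , a , suc b)
... | just (dec zero j k) with a
...   | zero = just (k , a , b)
...   | suc a' = just (j , a' , b)
step P (pc , a , b) | just (dec (suc _) j k) with b
...   | zero = just (k , a , b)
...   | suc b' = just (j , a , b')

runN : Program → ℕ → Config → Maybe Config
runN P zero c = just c
runN P (suc n) c = step P c >>= runN P n

Halts : Program → Set
Halts P = Σ ℕ λ n → runN P n (0 , 0 , 0) ≡ nothing

Undecidable : ∀ {a ℓ} {X : Set a} → (X → Set ℓ) → Set _
Undecidable P = Decidable P → Decidable Halts

{-# OPTIONS --safe #-}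
module Submission where

-- Halting of a two-counter machine P is reduced to satisfiability.
--
-- A run is written row by row as a word x₀ … x_ℓ.  Row k lists offsets 0 … W - 1
-- of the k-th configuration: every cell carries the program counter, a bit telling
-- whether it is the first of its row, and, for each counter, a bit telling whether
-- its offset is the value of the counter.  The row length W exceeds the number of
-- steps, so no counter leaves its row, and each row determines the next through
-- constraints between positions i, i + 1, i + W and i + 1 + W.
--
-- In a model, the word is an r-path.  A position with tile t has an s-edge to the
-- nominal t, from which an s-path leads, after N + 1 steps, to a mark of t.  Since
-- the nominals are all reached from the root by r-paths of one length N + 1, the
-- language rⁿsⁿ at the root forces the s-paths to be exactly as long.  Hence rⁿsⁿ
-- from position i leads to a mark of t only if position i + N + 2 has tile t, which
-- makes constraints at distance W = N + 2 expressible.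
--
-- From a model, N and ℓ are read off constructively, but the word only under a
-- double negation; this suffices, as "P halts within ℓ + 1 steps" is decidable.

open import Defs
open import Data.Bool using (Bool; true; false; _∧_; _∨_; not; if_then_else_)
import Data.Bool.Properties as Bool
open import Data.Empty using (⊥)
open import Data.Fin using (Fin; zero; suc; toℕ)
import Data.Fin.Properties as Fin
open import Data.Fin.Properties using (toℕ-injective)
open import Data.List using (List; []; _∷_; _++_; replicate; concatMap; cartesianProduct; cartesianProductWith; lookup; length)
open import Data.List.Membership.Propositional using (_∈_)
open import Data.List.Membership.Propositional.Properties using (∈-concatMap⁺; ∈-cartesianProduct⁺; ∈-cartesianProductWith⁺)
open import Data.List.Relation.Unary.All using (All; []; _∷_)
open import Data.List.Relation.Unary.Any as Any using (here; there; index)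
open import Data.List.Relation.Unary.Any.Properties using (lookup-index)
open import Data.Maybe using (Maybe; just; nothing)
open import Data.Nat
open import Data.Nat.DivMod
open import Data.Nat.Divisibility using (divides-refl)
open import Data.Nat.Properties
open import Data.Product using (Σ; _×_; _,_; proj₁; proj₂; ∃)
open import Data.Sum using (_⊎_; inj₁; inj₂)
open import Data.Unit using (⊤; tt)
open import Function using (_∘_; id)
open import Function.Bundles using (_⇔_; mk⇔; Equivalence)
open import Function.Construct.Composition using (_⇔-∘_)
open import Function.Construct.Symmetry using (⇔-sym)
open import Relation.Binary.PropositionalEquality
open import Relation.Nullary using (¬_; Dec; yes; no; does; contradiction)
open import Relation.Nullary.Decidable using (_×-dec_; _→-dec_; decidable-stable)
open import Relation.Nullary.Negation using (¬¬-map)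
open Equivalence using (to; from)

-- Paths as counted steps.

infixr 5 _∷_

data Steps {A : Set} (ρ : A → A → Set) : ℕ → A → A → Set where
  []  : ∀ {d} → Steps ρ 0 d d
  _∷_ : ∀ {n d e f} → ρ d e → Steps ρ n e f → Steps ρ (suc n) d f

path-++ : ∀ {I d m e u v} → Path I d u m → Path I m v e → Path I d (u ++ v) e
path-++ nil         q = q
path-++ (stepR x p) q = stepR x (path-++ p q)
path-++ (stepT x p) q = stepT x (path-++ p q)

path-split : ∀ {I d e} u {v} → Path I d (u ++ v) e → ∃ λ m → Path I d u m × Path I m v e
path-split []      p           = _ , nil , p
path-split (_ ∷ u) (stepR x p) = let m , p₁ , p₂ = path-split u p in m , stepR x p₁ , p₂
path-split (_ ∷ u) (stepT x p) = let m , p₁ , p₂ = path-split u p in m , stepT x p₁ , p₂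

steps→path : ∀ {I ρ n d e} → Steps (rol I ρ) n d e → Path I d (replicate n (role ρ)) e
steps→path []       = nil
steps→path (x ∷ xs) = stepR x (steps→path xs)

path→steps : ∀ {I ρ} n {d e} → Path I d (replicate n (role ρ)) e → Steps (rol I ρ) n d e
path→steps zero    nil         = []
path→steps (suc n) (stepR x p) = x ∷ path→steps n p

all≡-replicate : ∀ {A : Set} (x : A) n → All (_≡ x) (replicate n x)
all≡-replicate x zero    = []
all≡-replicate x (suc n) = refl ∷ all≡-replicate x n

all≡⇒replicate : ∀ {A : Set} {x : A} {w} → All (_≡ x) w → ∃ λ n → w ≡ replicate n x
all≡⇒replicate []          = 0 , refl
all≡⇒replicate (refl ∷ as) = let n , eq = all≡⇒replicate as in suc n , cong (_ ∷_) eq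

-- Five of the languages and their word-free semantics.

data Basic : Set where
  [r] [s] [r*] [s*] [rⁿsⁿ] : Basic

basic : Basic → RLang
basic [r]    = oneR
basic [s]    = oneS
basic [r*]   = rStar
basic [s*]   = sStar
basic [rⁿsⁿ] = rnsn

module Semantics (r s : ℕ) (I : Interp) where
  ρ σ : Δ I → Δ I → Set
  ρ = rol I (call r)
  σ = rol I (ret s)

  -- Step counts replace words, so that one reduction can serve automata and fixed languages alike.
  -- In `[rⁿsⁿ]` a single number counts both halves.
  Reach : Basic → Δ I → Δ I → Set
  Reach [r]    d e = ρ d e
  Reach [s]    d e = σ d e
  Reach [r*]   d e = ∃ λ n → Steps ρ n d e
  Reach [s*]   d e = ∃ λ n → Steps σ n d e
  Reach [rⁿsⁿ] d e = ∃ λ n → ∃ λ m → Steps ρ n d m × Steps σ n m e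

  Sem : Concept Basic → Δ I → Set
  Sem ⊤c        d = ⊤
  Sem (atom A)  d = con I A d
  Sem (nom a)   d = d ≡ ind I a
  Sem (neg C)   d = ¬ Sem C d
  Sem (and C D) d = Sem C d × Sem D d
  Sem (ex b C)  d = ∃ λ e → Reach b d e × Sem C e

  reach⇒path : ∀ b {d e} → Reach b d e → ∃ λ w → ⟦_⟧R r s (basic b) w × Path I d w e
  reach⇒path [r]  x       = _ , refl , stepR x nil
  reach⇒path [s]  x       = _ , refl , stepR x nil
  reach⇒path [r*] (n , p) = _ , all≡-replicate _ n , steps→path p
  reach⇒path [s*] (n , p) = _ , all≡-replicate _ n , steps→path p
  reach⇒path [rⁿsⁿ] (n , m , p , q) =
    _ , (n , refl) , path-++ (steps→path p) (steps→path q)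

  path⇒reach : ∀ b {d e w} → ⟦_⟧R r s (basic b) w → Path I d w e → Reach b d e
  path⇒reach [r]  refl (stepR x nil) = x
  path⇒reach [s]  refl (stepR x nil) = x
  path⇒reach [r*] all p with n , refl ← all≡⇒replicate all = n , path→steps n p
  path⇒reach [s*] all p with n , refl ← all≡⇒replicate all = n , path→steps n p
  path⇒reach [rⁿsⁿ] (n , refl) p =
    let m , p₁ , p₂ = path-split (replicate n _) p in n , m , path→steps n p₁ , path→steps n p₂

-- Transfer to any presentation of the five languages.

mapConcept : {L L′ : Set} → (L → L′) → Concept L → Concept L′
mapConcept f ⊤c        = ⊤c
mapConcept f (atom A)  = atom A
mapConcept f (nom a)   = nom a
mapConcept f (neg C)   = neg (mapConcept f C)
mapConcept f (and C D) = and (mapConcept f C) (mapConcept f D)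
mapConcept f (ex L C)  = ex (f L) (mapConcept f C)

module Transfer {Lang : Set} (⟦_⟧L : Lang → Word → Set) (r s : ℕ) (lang : Basic → Lang)
                (lang-spec : ∀ b w → ⟦ lang b ⟧L w ⇔ ⟦_⟧R r s (basic b) w) where

  module _ (I : Interp) where
    open Semantics r s I

    sem⇔ : ∀ C d → ⟦_⟧ ⟦_⟧L I (mapConcept lang C) d ⇔ Sem C d
    sem⇔ ⊤c        d = mk⇔ _ _
    sem⇔ (atom A)  d = mk⇔ (λ x → x) (λ x → x)
    sem⇔ (nom a)   d = mk⇔ (λ x → x) (λ x → x)
    sem⇔ (neg C)   d = mk⇔ (_∘ from (sem⇔ C d)) (_∘ to (sem⇔ C d))
    sem⇔ (and C D) d = mk⇔ (λ (x , y) → to (sem⇔ C d) x , to (sem⇔ D d) y)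
                           (λ (x , y) → from (sem⇔ C d) x , from (sem⇔ D d) y)
    sem⇔ (ex b C)  d = mk⇔
      (λ (e , w , l , p , c) → e , path⇒reach b (to (lang-spec b w) l) p , to (sem⇔ C e) c)
      (λ (e , x , c) → let w , l , p = reach⇒path b x
                       in e , w , from (lang-spec b w) l , p , from (sem⇔ C e) c)

  sat⇔ : ∀ C → Satisfiable ⟦_⟧L (mapConcept lang C) ⇔ Σ Interp λ I → ∃ λ d → Semantics.Sem r s I C d
  sat⇔ C = mk⇔ (λ (I , d , c) → I , d , to (sem⇔ I C d) c) (λ (I , d , c) → I , d , from (sem⇔ I C d) c)

-- Visibly pushdown automata

pattern 0F = zero
pattern 1F = suc zero
pattern 2F = suc (suc zero)
pattern 3F = suc (suc (suc zero))

R S : Letter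
R = role (call 0)
S = role (ret 0)

-- For rⁿsⁿ, the first r pushes the marker 0F and every later one pushes 1F:
-- popping the marker is what sends the automaton back to a final state.
vpa : Basic → VPA
vpa [r] = record
  { nQ = 2 ; nΓ = 1 ; init = 0F ; final = 1F ∷ []
  ; callT = (0F , 0 , 1F , 0F) ∷ [] ; intT = [] ; retT = [] }
vpa [s] = record
  { nQ = 2 ; nΓ = 0 ; init = 0F ; final = 1F ∷ []
  ; callT = [] ; intT = [] ; retT = (0F , 0 , nothing , 1F) ∷ [] }
vpa [r*] = record
  { nQ = 1 ; nΓ = 1 ; init = 0F ; final = 0F ∷ []
  ; callT = (0F , 0 , 0F , 0F) ∷ [] ; intT = [] ; retT = [] }
vpa [s*] = record
  { nQ = 1 ; nΓ = 0 ; init = 0F ; final = 0F ∷ []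
  ; callT = [] ; intT = [] ; retT = (0F , 0 , nothing , 0F) ∷ [] }
vpa [rⁿsⁿ] = record
  { nQ = 4 ; nΓ = 2 ; init = 0F ; final = 0F ∷ 3F ∷ []
  ; callT = (0F , 0 , 1F , 0F) ∷ (1F , 0 , 1F , 1F) ∷ []
  ; intT = []
  ; retT = (1F , 0 , just 1F , 2F) ∷ (2F , 0 , just 1F , 2F)
         ∷ (1F , 0 , just 0F , 3F) ∷ (2F , 0 , just 0F , 3F) ∷ [] }

run-r* : ∀ {σ w f} → Run (vpa [r*]) 0F σ w f → All (_≡ R) w
run-r* done = []
run-r* (callS (here refl) x) = refl ∷ run-r* x

-- Every r pushes and nothing pops, so the induction has to range over all stacks.
r*-run : ∀ {w} σ → All (_≡ R) w → Run (vpa [r*]) 0F σ w 0F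
r*-run σ []          = done
r*-run σ (refl ∷ as) = callS (here refl) (r*-run (0F ∷ σ) as)

-- The stack stays empty, so every s is read by a transition at the bottom.
run-s* : ∀ {w f} → Run (vpa [s*]) 0F [] w f → All (_≡ S) w
run-s* done = []
run-s* (retB (here refl) x) = refl ∷ run-s* x

s*-run : ∀ {w} → All (_≡ S) w → Run (vpa [s*]) 0F [] w 0F
s*-run []          = done
s*-run (refl ∷ as) = retB (here refl) (s*-run as)

-- The stack after n + 1 calls, top first: the marker lies deepest.
stack : ℕ → List (Fin 2)
stack n = replicate n 1F ++ 0F ∷ []

-- No transition leaves state `3F`.
end₃ : ∀ {σ w f} → Run (vpa [rⁿsⁿ]) 3F σ w f → w ≡ []
end₃ done = refl
end₃ (callS (there (there ())) _)
end₃ (intS () _)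
end₃ (retS (there (there (there (there ())))) _)
end₃ (retB (there (there (there (there ())))) _)

-- State `2F` is not final and reads no calls, so acceptance requires popping the marker from below
-- n other symbols.
pops : ∀ n {w f} → Run (vpa [rⁿsⁿ]) 2F (stack n) w f → f ∈ 0F ∷ 3F ∷ [] → w ≡ replicate (suc n) S
pops zero    done (there (there ()))
pops (suc n) done (there (there ()))
pops zero    (callS (there (there ())) _) f∈
pops (suc n) (callS (there (there ())) _) f∈
pops zero    (intS () _) f∈
pops (suc n) (intS () _) f∈
pops zero    (retS (there (there (there (here refl)))) x) f∈ = cong (S ∷_) (end₃ x)
pops (suc n) (retS (there (here refl)) x)                 f∈ = cong (S ∷_) (pops n x f∈)
pops (suc n) (retS (there (there (there (there ())))) _) f∈

-- The k calls still to come raise the stack to k + n + 1 symbols, each of which costs one s.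
pushes : ∀ n {w f} → Run (vpa [rⁿsⁿ]) 1F (stack n) w f → f ∈ 0F ∷ 3F ∷ [] →
         ∃ λ k → w ≡ replicate k R ++ replicate (k + suc n) S
pushes zero    done (there (there ()))
pushes (suc n) done (there (there ()))
pushes zero    (callS (there (here refl)) x) f∈ with k , refl ← pushes 1 x f∈ =
  suc k , cong (λ m → R ∷ replicate k R ++ replicate m S) (+-suc k 1)
pushes (suc n) (callS (there (here refl)) x) f∈ with k , refl ← pushes (suc (suc n)) x f∈ =
  suc k , cong (λ m → R ∷ replicate k R ++ replicate m S) (+-suc k (suc (suc n)))
pushes zero    (intS () _) f∈
pushes (suc n) (intS () _) f∈
pushes zero    (retS (there (there (here refl))) x) f∈ = 0 , cong (S ∷_) (end₃ x)
pushes zero    (retS (there (there (there (there ())))) _) f∈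
pushes (suc n) (retS (here refl) x)                 f∈ = 0 , cong (S ∷_) (pops n x f∈)
pushes (suc n) (retS (there (there (there (there ())))) _) f∈

run-pops : ∀ n → Run (vpa [rⁿsⁿ]) 2F (stack n) (replicate (suc n) S) 3F
run-pops zero    = retS (there (there (there (here refl)))) done
run-pops (suc n) = retS (there (here refl)) (run-pops n)

run-pushes : ∀ n k → Run (vpa [rⁿsⁿ]) 1F (stack n) (replicate k R ++ replicate (k + suc n) S) 3F
run-pushes zero    zero    = retS (there (there (here refl))) done
run-pushes (suc n) zero    = retS (here refl) (run-pops n)
run-pushes n       (suc k) = callS (there (here refl))
  (subst (λ m → Run (vpa [rⁿsⁿ]) 1F (stack (suc n)) (replicate k R ++ replicate m S) 3F)
         (+-suc k (suc n)) (run-pushes (suc n) k))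

vpa-spec : ∀ b w → Accepts (vpa b) w ⇔ ⟦_⟧R 0 0 (basic b) w
vpa-spec [r] w = mk⇔ (λ (_ , f∈ , x) → ⇒ f∈ x) λ { refl → 1F , here refl , callS (here refl) done }
  where
  ⇒ : ∀ {f w} → f ∈ 1F ∷ [] → Run (vpa [r]) 0F [] w f → w ≡ R ∷ []
  ⇒ (here refl) (callS (here refl) done) = refl
  ⇒ (here refl) (callS (here refl) (callS (there ()) _))
vpa-spec [s] w = mk⇔ (λ (_ , f∈ , x) → ⇒ f∈ x) λ { refl → 1F , here refl , retB (here refl) done }
  where
  ⇒ : ∀ {f w} → f ∈ 1F ∷ [] → Run (vpa [s]) 0F [] w f → w ≡ S ∷ []
  ⇒ (here refl) (retB (here refl) done) = refl
  ⇒ (here refl) (retB (here refl) (retB (there ()) _))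
vpa-spec [r*] w = mk⇔ (λ (_ , _ , x) → run-r* x) (λ as → 0F , here refl , r*-run [] as)
vpa-spec [s*] w = mk⇔ (λ (_ , _ , x) → run-s* x) (λ as → 0F , here refl , s*-run as)
vpa-spec [rⁿsⁿ] w = mk⇔ (λ (_ , f∈ , x) → ⇒ f∈ x) λ (n , w≡) → ⇐ n w≡
  where
  ⇒ : ∀ {f w} → f ∈ 0F ∷ 3F ∷ [] → Run (vpa [rⁿsⁿ]) 0F [] w f → ⟦_⟧R 0 0 rnsn w
  ⇒ f∈ done = 0 , refl
  ⇒ f∈ (callS (here refl) x) with k , refl ← pushes 0 x f∈ =
    suc k , cong (λ m → R ∷ replicate k R ++ replicate m S) (+-comm k 1)
  ⇒ f∈ (callS (there (there ())) x)
  ⇒ f∈ (intS () x)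
  ⇒ f∈ (retB (there (there (there (there ())))) x)

  ⇐ : ∀ {w} n → w ≡ replicate n R ++ replicate n S → Accepts (vpa [rⁿsⁿ]) w
  ⇐ zero    refl = 0F , here refl , done
  ⇐ (suc k) refl = 3F , there (here refl) , callS (here refl)
    (subst (λ m → Run (vpa [rⁿsⁿ]) 1F (stack 0) (replicate k R ++ replicate m S) 3F)
           (+-comm k 1) (run-pushes 0 k))

-- Double negation and the nodes of a path.

_¬¬>>=_ : {A B : Set} → ¬ ¬ A → (A → ¬ ¬ B) → ¬ ¬ B
(m ¬¬>>= f) k = m λ a → f a k

steps-split : ∀ {A : Set} {ρ : A → A → Set} m {n d f} → Steps ρ (m + n) d f →
              ∃ λ e → Steps ρ m d e × Steps ρ n e f
steps-split zero    p       = _ , [] , p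
steps-split (suc m) (x ∷ p) = let e , p₁ , p₂ = steps-split m p in e , x ∷ p₁ , p₂

_++ˢ_ : ∀ {A : Set} {ρ : A → A → Set} {m n d e f} → Steps ρ m d e → Steps ρ n e f → Steps ρ (m + n) d f
[]       ++ˢ q = q
(x ∷ p) ++ˢ q = x ∷ (p ++ˢ q)

_∷ʳˢ_ : ∀ {A : Set} {ρ : A → A → Set} {n d e f} → Steps ρ n d e → ρ e f → Steps ρ (suc n) d f
[]      ∷ʳˢ y = y ∷ []
(x ∷ p) ∷ʳˢ y = x ∷ (p ∷ʳˢ y)

node : ∀ {A : Set} {ρ : A → A → Set} {n d e} → Steps ρ n d e → ℕ → A
node {d = d} p        zero   = d
-- Default value: past its end, a path repeats its last point.
node {d = d} []      (suc i) = d
node         (x ∷ p) (suc i) = node p i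

node-last : ∀ {A : Set} {ρ : A → A → Set} {n d e} (p : Steps ρ n d e) → node p n ≡ e
node-last []      = refl
node-last (x ∷ p) = node-last p

node-steps : ∀ {A : Set} {ρ : A → A → Set} {n d e} (p : Steps ρ n d e) i k → i + k ≤ n →
             Steps ρ k (node p i) (node p (i + k))
node-steps p       zero    zero    _         = []
node-steps (x ∷ p) zero    (suc k) (s≤s k≤n) = x ∷ node-steps p zero k k≤n
node-steps (x ∷ p) (suc i) k       (s≤s i≤n) = node-steps p i k i≤n

node-step : ∀ {A : Set} {ρ : A → A → Set} {n d e} (p : Steps ρ n d e) i → suc i ≤ n →
            ρ (node p i) (node p (suc i))
node-step (x ∷ p) zero    _         = x
node-step (x ∷ p) (suc i) (s≤s i<n) = node-step p i i<n

-- Finitely many choices can be made one after another under double negation. Beyond ℓ the function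
-- repeats its last value.
¬¬-choice : ∀ {A : Set} ℓ {T : ℕ → A → Set} → (∀ i → i ≤ ℓ → ¬ ¬ ∃ (T i)) →
            ¬ ¬ ∃ λ (w : ℕ → A) → ∀ i → i ≤ ℓ → T i (w i)
¬¬-choice zero    h = ¬¬-map (λ (t , p) → (λ _ → t) , λ { zero _ → p }) (h 0 z≤n)
¬¬-choice (suc ℓ) h = h 0 z≤n ¬¬>>= λ (t , p) →
  ¬¬-map (λ (w , q) → (λ { zero → t ; (suc i) → w i }) ,
                      λ { zero _ → p ; (suc i) (s≤s i≤ℓ) → q i i≤ℓ })
         (¬¬-choice ℓ (λ i i≤ℓ → h (suc i) (s≤s i≤ℓ)))

-- From puzzles to concepts

-- A solution with stride W is a word w₀ … w_ℓ read as the rows, of length W, of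
-- a grid, so that positions i and i + W are vertical neighbours.
record Puzzle : Set₁ where
  field
    K                   : ℕ
    Start Final Blank   : Fin K → Set
    Hor                 : Fin K → Fin K → Set
    Ver Dia             : Fin K → Fin K → Fin K → Set
    start? : ∀ t → Dec (Start t)
    final? : ∀ t → Dec (Final t)
    blank? : ∀ t → Dec (Blank t)
    hor?   : ∀ t u → Dec (Hor t u)
    ver?   : ∀ t u v → Dec (Ver t u v)
    dia?   : ∀ t u v → Dec (Dia t u v)

record Solution (Q : Puzzle) (W ℓ : ℕ) (w : ℕ → Fin (Puzzle.K Q)) : Set where
  open Puzzle Q
  field
    starts : Start (w 0)
    ends   : Final (w ℓ)
    blanks : ∀ i → suc i < W → suc i ≤ ℓ → Blank (w (suc i))
    hor    : ∀ i → suc i ≤ ℓ → Hor (w i) (w (suc i))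
    ver    : ∀ i → i + W ≤ ℓ → Ver (w i) (w (suc i)) (w (i + W))
    dia    : ∀ i → suc i + W ≤ ℓ → Dia (w i) (w (suc i)) (w (suc i + W))

⋀ : ∀ {L K} → (Fin K → Concept L) → Concept L
⋀ {K = zero}  C = ⊤c
⋀ {K = suc K} C = and (C zero) (⋀ (C ∘ suc))

-- Whether a combination of tiles is allowed is decided while the concept is built; only the
-- disallowed ones contribute a negation.
forbid : ∀ {L} {A : Set} → Dec A → Concept L → Concept L
forbid a? C = if does a? then ⊤c else neg C

module _ {r s : ℕ} {I : Interp} where
  open Semantics r s I

  ⋀⇔ : ∀ {K} (C : Fin K → Concept Basic) {d} → Sem (⋀ C) d ⇔ (∀ t → Sem (C t) d)
  ⋀⇔ {zero}  C = mk⇔ (λ _ ()) _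
  ⋀⇔ {suc K} C = mk⇔ (λ { (c , cs) zero → c ; (c , cs) (suc t) → to (⋀⇔ (C ∘ suc)) cs t })
                      (λ h → h zero , from (⋀⇔ (C ∘ suc)) (h ∘ suc))

  -- A negated concept already refutes a doubly negated witness, so exact constraints on tiles
  -- survive the double negations of the model.
  forbid⇒ : ∀ {A} (a? : Dec A) C {d} → Sem (forbid a? C) d → ¬ ¬ Sem C d → A
  forbid⇒ (yes a) C h  ¬¬c = a
  forbid⇒ (no ¬a) C ¬c ¬¬c = contradiction ¬c ¬¬c

  forbid⇐ : ∀ {A} (a? : Dec A) C {d} → (Sem C d → A) → Sem (forbid a? C) d
  forbid⇐ (yes a) C h = tt
  forbid⇐ (no ¬a) C h = ¬a ∘ h

-- The concept of a puzzle.

module Encoding (Q : Puzzle) where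
  open Puzzle Q

  goal : Concept Basic
  goal = atom 0

  tile : Fin K → Concept Basic
  tile t = atom (suc (toℕ t))

  -- The far end of the yardstick that starts at the nominal t.
  mark : Fin K → Concept Basic
  mark t = and goal (tile t)

  hook : Fin K → Concept Basic
  hook t = nom (toℕ t)

  -- The first negation lets an s-path end only at a goal; the second puts the tile t on every goal
  -- it meets.
  yardstick : Fin K → Concept Basic
  yardstick t = ex [r] (and (hook t)
    (and (neg (ex [s*] (and (neg goal) (neg (ex [s] ⊤c)))))
         (neg (ex [s*] (and goal (neg (tile t)))))))

  untiled : Concept Basic
  untiled = ⋀ λ t → neg (tile t)

  unhooked : Fin K → Concept Basic
  unhooked t = and (tile t) (neg (ex [s] (hook t)))

  horBad : Fin K → Fin K → Concept Basic
  horBad t u = ex [r*] (and (tile t) (ex [r] (tile u)))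

  -- The mark is sought from the cell with tile t in `verBad` and from its right neighbour in
  -- `diaBad`, so v lies one stride after t or after u.
  verBad diaBad : Fin K → Fin K → Fin K → Concept Basic
  verBad t u v = ex [r*] (and (tile t) (and (ex [r] (tile u)) (ex [rⁿsⁿ] (mark v))))
  diaBad t u v = ex [r*] (and (tile t) (ex [r] (and (tile u) (ex [rⁿsⁿ] (mark v)))))

  -- The words r rⁿ sⁿ s s s* fall short of the stride by at least one r.
  blankBad : Fin K → Concept Basic
  blankBad t = ex [r] (ex [rⁿsⁿ] (ex [s] (ex [s] (ex [s*] (mark t)))))

  spine : Concept Basic
  spine = and (⋀ λ t → forbid (start? t) (tile t))
         (and (neg (ex [r*] untiled))
         (and (⋀ λ t → neg (ex [r*] (unhooked t)))
         (and (⋀ λ t → forbid (blank? t) (blankBad t))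
         (and (⋀ λ t → ⋀ λ u → forbid (hor? t u) (horBad t u))
         (and (⋀ λ t → ⋀ λ u → ⋀ λ v → forbid (ver? t u v) (verBad t u v))
         (and (⋀ λ t → ⋀ λ u → ⋀ λ v → forbid (dia? t u v) (diaBad t u v))
              (ex [r*] (⋀ λ t → forbid (final? t) (tile t)))))))))

  -- The first two conjuncts say that balanced words from the root end in goals and that words with
  -- a surplus of r never do. This fixes the length of all yardsticks at once. The word hangs on an
  -- s-edge, so that balanced words from the root need not enter it.
  concept : Concept Basic
  concept = and (neg (ex [rⁿsⁿ] (neg goal)))
           (and (neg (ex [r] (ex [r*] (ex [rⁿsⁿ] goal))))
           (and (ex [r*] (⋀ yardstick))
                (ex [s] spine)))

  -- From models to solutions.

  module _ (r s : ℕ) (I : Interp) where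
    open Semantics r s I

    sound : ∀ {a} → Sem concept a → ∃ λ N → ∃ λ ℓ → ¬ ¬ ∃ (Solution Q (suc (suc N)) ℓ)
    sound {a} (all-goal , no-goal , (p , (N , a→p) , yards) , x₀ , _ , start , tiled , hooked ,
               blank , hor , ver , dia , e , (ℓ , path) , final) =
      N , ℓ , ¬¬-map (λ (w , q) → w , solution w q)
        (¬¬-choice ℓ λ i i≤ℓ → ¬¬-tile (λ untiled → tiled (x i , (i , reach i i≤ℓ) , untiled)))
      where
      W = suc (suc N)

      x : ℕ → Δ I
      x = node path

      reach : ∀ i → i ≤ ℓ → Steps ρ i x₀ (x i)
      reach i = node-steps path 0 i

      ¬¬-tile : ∀ {d} → ¬ Sem untiled d → ¬ ¬ ∃ λ t → Sem (tile t) d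
      ¬¬-tile h k = h (from (⋀⇔ (λ t → neg (tile t))) λ t c → k (t , c))

      Hook : Fin K → Δ I
      Hook t = ind I (toℕ t)

      a→hook : ∀ t → Steps ρ (suc N) a (Hook t)
      a→hook t with h , p→h , refl , _ ← to (⋀⇔ yardstick) yards t = a→p ∷ʳˢ p→h

      -- The N + 1 r-steps to the nominal split into 1, N - j and j. The last j balance the s-steps,
      -- and the first one is the surplus that rules out a goal.
      short-of-goal : ∀ {t v} j → j < suc N → Steps σ j (Hook t) v → ¬ Sem goal v
      short-of-goal {t} j (s≤s j≤N) q g
        with y ∷ p ← subst (λ n → Steps ρ (suc n) a (Hook t)) (sym (m∸n+n≡m j≤N)) (a→hook t)
        with m , p₁ , p₂ ← steps-split (N ∸ j) p =
        no-goal (_ , y , _ , (N ∸ j , p₁) , _ , (j , _ , p₂ , q) , g)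

      -- Points before step N + 1 are no goals, hence cannot be dead ends.
      climb : ∀ t j → j ≤ suc N → ¬ ¬ ∃ (Steps σ j (Hook t))
      climb t zero    _   k = k (_ , [])
      climb t (suc j) j<N = climb t j (<⇒≤ j<N) ¬¬>>= step-up
        where
        step-up : ∃ (Steps σ j (Hook t)) → ¬ ¬ ∃ (Steps σ (suc j) (Hook t))
        step-up (v , q) k with h , _ , refl , go-on , _ ← to (⋀⇔ yardstick) yards t =
          go-on (v , (j , q) , short-of-goal j j<N q , λ (u , v→u , _) → k (u , q ∷ʳˢ v→u))

      -- With N + 1 steps each way the word is balanced, so the point reached is a goal, and the
      -- yardstick gives it the tile.
      mark-end : ∀ t → ¬ ¬ ∃ λ v → Steps σ (suc N) (Hook t) v × Sem (mark t) v
      mark-end t = climb t (suc N) ≤-refl ¬¬>>= at-end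
        where
        at-end : ∃ (Steps σ (suc N) (Hook t)) → ¬ ¬ ∃ λ v → Steps σ (suc N) (Hook t) v × Sem (mark t) v
        at-end (v , q) k with h , _ , refl , _ , is-tile ← to (⋀⇔ yardstick) yards t =
          all-goal (v , (suc N , _ , a→hook t , q) , λ g →
          is-tile (v , (suc N , q) , g , λ c → k (v , q , g , c)))

      module _ (w : ℕ → Fin K) (tile-at : ∀ i → i ≤ ℓ → Sem (tile (w i)) (x i)) where

        descend : ∀ i → i ≤ ℓ → ¬ ¬ ∃ λ v → Steps σ W (x i) v × Sem (mark (w i)) v
        descend i i≤ℓ k = to (⋀⇔ (λ t → neg (ex [r*] (unhooked t)))) hooked (w i)
          (x i , (i , reach i i≤ℓ) , tile-at i i≤ℓ , λ { (_ , y , refl) →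
            mark-end (w i) λ (v , q , m) → k (v , y ∷ q , m) })

        -- W r-steps lead on to position i + W, and W s-steps lead from there to its mark.
        see : ∀ i → i + W ≤ ℓ → ¬ ¬ Sem (ex [rⁿsⁿ] (mark (w (i + W)))) (x i)
        see i i≤ℓ = ¬¬-map (λ (v , q , m) → v , (W , _ , node-steps path i W i≤ℓ , q) , m)
                           (descend (i + W) i≤ℓ)

        solution : Solution Q W ℓ w
        solution = record
          { starts = forbid⇒ (start? _) (tile _) (to (⋀⇔ λ t → forbid (start? t) (tile t)) start _)
                       (λ k → k (tile-at 0 z≤n))
          ; ends   = forbid⇒ (final? _) (tile _) (to (⋀⇔ λ t → forbid (final? t) (tile t)) final _)
                       (λ k → k (subst (Sem (tile (w ℓ))) (node-last path) (tile-at ℓ ≤-refl)))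
          ; blanks = λ i i<W i≤ℓ →
              forbid⇒ (blank? _) (blankBad _) (to (⋀⇔ λ t → forbid (blank? t) (blankBad t)) blank _)
                (see-early i i<W i≤ℓ)
          ; hor    = λ i i≤ℓ →
              forbid⇒ (hor? _ _) (horBad _ _) (to (⋀⇔ _) (to (⋀⇔ _) hor (w i)) (w (suc i)))
                λ k → k (x i , (i , reach i (<⇒≤ i≤ℓ)) , tile-at i (<⇒≤ i≤ℓ) ,
                         x (suc i) , node-step path i i≤ℓ , tile-at (suc i) i≤ℓ)
          ; ver    = λ i i≤ℓ → let i<ℓ = ≤-trans (m<m+n i z<s) i≤ℓ in
              forbid⇒ (ver? _ _ _) (verBad _ _ _)
                (to (⋀⇔ _) (to (⋀⇔ _) (to (⋀⇔ _) ver (w i)) (w (suc i))) (w (i + W)))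
                (¬¬-map (λ m → x i , (i , reach i (<⇒≤ i<ℓ)) , tile-at i (<⇒≤ i<ℓ) ,
                           (x (suc i) , node-step path i i<ℓ , tile-at (suc i) i<ℓ) , m)
                        (see i i≤ℓ))
          ; dia    = λ i i≤ℓ → let i<ℓ = ≤-trans (m≤m+n (suc i) W) i≤ℓ in
              forbid⇒ (dia? _ _ _) (diaBad _ _ _)
                (to (⋀⇔ _) (to (⋀⇔ _) (to (⋀⇔ _) dia (w i)) (w (suc i))) (w (suc i + W)))
                (¬¬-map (λ m → x i , (i , reach i (<⇒≤ i<ℓ)) , tile-at i (<⇒≤ i<ℓ) ,
                           x (suc i) , node-step path i i<ℓ , tile-at (suc i) i<ℓ , m)
                        (see (suc i) i≤ℓ))
          }
          where
          -- After the first r, i further r-steps are balanced by i s-steps. Since i ≤ N, the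
          -- remaining N - i + 2 include the two explicit ones of `blankBad`.
          see-early : ∀ i → suc i < W → suc i ≤ ℓ → ¬ ¬ Sem (blankBad (w (suc i))) x₀
          see-early i (s≤s (s≤s i≤N)) i≤ℓ = ¬¬-map from-mark (descend (suc i) i≤ℓ)
            where
            i+rest : W ≡ i + suc (suc (N ∸ i))
            i+rest = sym (trans (+-suc i _) (cong suc (trans (+-suc i _) (cong suc (m+[n∸m]≡n i≤N)))))

            from-mark : (∃ λ v → Steps σ W (x (suc i)) v × Sem (mark (w (suc i))) v) →
                        Sem (blankBad (w (suc i))) x₀
            from-mark (v , q , m)
              with u , q₁ , y₁ ∷ y₂ ∷ q₂ ← steps-split i (subst (λ n → Steps σ n (x (suc i)) v) i+rest q)
              with x₀→x₁ ∷ p ← reach (suc i) i≤ℓ =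
              _ , x₀→x₁ , u , (i , _ , p , q₁) , _ , y₁ , _ , y₂ , v , (N ∸ i , q₂) , m

-- The model of a solution.

module Model (Q : Puzzle) (N ℓ : ℕ) (w : ℕ → Fin (Puzzle.K Q)) where
  open Puzzle Q
  open Encoding Q

  -- up i is the common r-path to the yardsticks, down t j the yardstick of
  -- tile t, and spot i the i-th position of the word.
  data Point : Set where
    up   : ℕ → Point
    down : ℕ → ℕ → Point
    spot : ℕ → Point

  data _→r_ : Point → Point → Set where
    climb : ∀ {i} → i < N → up i →r up (suc i)
    turn  : ∀ {t} → up N →r down t 0
    next  : ∀ {i} → i < ℓ → spot i →r spot (suc i)

  data _→s_ : Point → Point → Set where
    descend : ∀ {t j} → j < suc N → down t j →s down t (suc j)
    read    : ∀ {i} → spot i →s down (toℕ (w i)) 0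
    enter   : up 0 →s spot 0

  Holds : ℕ → Point → Set
  -- The root must be a goal because rⁿsⁿ contains the empty word.
  Holds n (up i)     = n ≡ 0 × i ≡ 0
  Holds n (down t j) = j ≡ suc N × (n ≡ 0 ⊎ n ≡ suc t)
  Holds n (spot i)   = n ≡ suc (toℕ (w i))

  -- All call roles share one relation and all return roles another, so the model serves every
  -- choice of r and s.
  edges : RoleName → Point → Point → Set
  edges (call _) = _→r_
  edges (int _)  = λ _ _ → ⊥
  edges (ret _)  = _→s_

  model : Interp
  model = record { Δ = Point ; elt = up 0 ; ind = λ t → down t 0 ; con = Holds ; rol = edges }

  climbs : ∀ k i → k + i ≤ N → Steps _→r_ k (up i) (up (k + i))
  climbs zero    i h = []
  climbs (suc k) i h = climbs k i (<⇒≤ h) ∷ʳˢ climb h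

  nexts : ∀ k → k ≤ ℓ → Steps _→r_ k (spot 0) (spot k)
  nexts zero    h = []
  nexts (suc k) h = nexts k (<⇒≤ h) ∷ʳˢ next h

  -- Nominals have no outgoing r-edge, so an r-path can leave the common path only with its last
  -- step.
  up-r : ∀ {n i v} → Steps _→r_ n (up i) v →
         v ≡ up (n + i) ⊎ ((∃ λ t → v ≡ down t 0) × n + i ≡ suc N)
  up-r []              = inj₁ refl
  up-r (turn ∷ [])     = inj₂ ((_ , refl) , refl)
  up-r (turn ∷ (() ∷ _))
  up-r {suc n} {i} (climb _ ∷ p) with up-r p
  ... | inj₁ eq       = inj₁ (trans eq (cong up (+-suc n i)))
  ... | inj₂ (d , eq) = inj₂ (d , trans (sym (+-suc n i)) eq)

  down-s : ∀ {n t j v} → Steps _→s_ n (down t j) v → v ≡ down t (n + j)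
  down-s []                            = refl
  down-s {suc n} {t} {j} (descend _ ∷ p) = trans (down-s p) (cong (down t) (+-suc n j))

  down-s≤ : ∀ {n t j v} → j ≤ suc N → Steps _→s_ n (down t j) v → n + j ≤ suc N
  down-s≤ h []                            = h
  down-s≤ {suc n} {t} {j} h (descend j< ∷ p) = subst (_≤ suc N) (+-suc n j) (down-s≤ j< p)

  spot-r : ∀ {n i v} → i ≤ ℓ → Steps _→r_ n (spot i) v → v ≡ spot (n + i) × n + i ≤ ℓ
  spot-r h []                     = refl , h
  spot-r {suc n} {i} h (next i< ∷ p) =
    let eq , le = spot-r i< p in trans eq (cong spot (+-suc n i)) , subst (_≤ ℓ) (+-suc n i) le

  module _ (r s : ℕ) where
    open Semantics r s model

    -- A position has one s-edge, to the nominal of its own tile, and the only goal on a yardstick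
    -- is its end.
    spot-mark : ∀ {n i v t} → Steps _→s_ n (spot i) v → Sem (mark t) v →
                n ≡ suc (suc N) × t ≡ w i
    spot-mark [] (() , _)
    spot-mark {suc n} (read ∷ p) m with refl ← down-s p with m
    ... | (end , _) , _ , inj₂ eq =
      cong suc (trans (sym (+-identityʳ n)) end) , toℕ-injective (suc-injective eq)

    -- The mark fixes the number of s-steps at N + 2, and the same number of r-steps led to the
    -- position carrying t.
    rⁿsⁿ-mark : ∀ {i t} → i ≤ ℓ → Sem (ex [rⁿsⁿ] (mark t)) (spot i) →
                i + suc (suc N) ≤ ℓ × t ≡ w (i + suc (suc N))
    rⁿsⁿ-mark {i} h (v , (n , m , p , q) , c)
      with refl , n+i≤ℓ ← spot-r h p with refl , refl ← spot-mark q c =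
      subst (_≤ ℓ) (+-comm n i) n+i≤ℓ , cong w (+-comm n i)

    spot-r* : ∀ {C} → Sem (ex [r*] C) (spot 0) → ∃ λ i → i ≤ ℓ × Sem C (spot i)
    spot-r* {C} (_ , (n , p) , c) with refl , h ← spot-r z≤n p = n + 0 , h , c

    tile-eq : ∀ {t i} → Sem (tile t) (spot i) → t ≡ w i
    tile-eq = toℕ-injective ∘ suc-injective

    complete : Solution Q (suc (suc N)) ℓ w → Sem concept (up 0)
    complete sol = all-goal , no-goal , yards , spot 0 , enter ,
      start , tiled , from (⋀⇔ λ t → neg (ex [r*] (unhooked t))) hooked ,
      from (⋀⇔ λ t → forbid (blank? t) (blankBad t)) (λ t → forbid⇐ (blank? t) (blankBad t) blank) ,
      from (⋀⇔ _) (λ t → from (⋀⇔ _) λ u → forbid⇐ (hor? t u) (horBad t u) hor-ok) ,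
      from (⋀⇔ _) (λ t → from (⋀⇔ _) λ u → from (⋀⇔ _) λ v →
        forbid⇐ (ver? t u v) (verBad t u v) ver-ok) ,
      from (⋀⇔ _) (λ t → from (⋀⇔ _) λ u → from (⋀⇔ _) λ v →
        forbid⇐ (dia? t u v) (diaBad t u v) dia-ok) ,
      spot ℓ , (ℓ , nexts ℓ ≤-refl) ,
      from (⋀⇔ λ t → forbid (final? t) (tile t)) λ t →
        forbid⇐ (final? t) (tile t) λ c → subst Final (sym (tile-eq c)) ends
      where
      open Solution sol

      all-goal : ¬ Sem (ex [rⁿsⁿ] (neg goal)) (up 0)
      all-goal (_ , (n , _ , p , q) , ¬g) with up-r p
      all-goal (_ , (zero , _ , p , []) , ¬g)          | inj₁ refl = ¬g (refl , refl)
      -- On the common path only the root has an s-edge.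
      all-goal (_ , (suc n , _ , p , (() ∷ q)) , ¬g)   | inj₁ refl
      all-goal (_ , (n , _ , p , q) , ¬g)              | inj₂ ((t , refl) , eq)
        with refl ← down-s q = ¬g (eq , inj₁ refl)

      no-goal : ¬ Sem (ex [r] (ex [r*] (ex [rⁿsⁿ] goal))) (up 0)
      no-goal (_ , y , _ , (k , p₁) , _ , (n , _ , p₂ , q) , g) with up-r (y ∷ (p₁ ++ˢ p₂))
      no-goal (_ , y , _ , (k , p₁) , _ , (zero , _ , p₂ , []) , _ , ())    | inj₁ refl
      no-goal (_ , y , _ , (k , p₁) , _ , (suc n , _ , p₂ , (() ∷ q)) , g)  | inj₁ refl
      -- Reaching the nominal took 1 + k + n = N + 1 steps, so n s-steps stop before the end of the
      -- yardstick.
      no-goal (_ , y , _ , (k , p₁) , _ , (n , _ , p₂ , q) , g)             | inj₂ ((t , refl) , eq)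
        with refl ← down-s q = <-irrefl (trans (proj₁ g) (sym eq))
          (s≤s (+-monoˡ-≤ 0 (m≤n+m n k)))

      yards : Sem (ex [r*] (⋀ yardstick)) (up 0)
      yards = up (N + 0) , (N , climbs N 0 (≤-reflexive (+-identityʳ N))) ,
        from (⋀⇔ yardstick) λ t → down (toℕ t) 0 ,
          subst (λ n → up n →r down (toℕ t) 0) (sym (+-identityʳ N)) turn , refl ,
          go-on , λ { (_ , (n , q) , g , ¬c) → is-tile t q g ¬c }
        where
        go-on : ∀ {t} → ¬ Sem (ex [s*] (and (neg goal) (neg (ex [s] ⊤c)))) (down t 0)
        go-on (_ , (n , q) , ¬g , stuck) with refl ← down-s q with n + 0 <? suc N
        ... | yes h = stuck (_ , descend h , tt)
        ... | no h = ¬g (≤-antisym (down-s≤ z≤n q) (≮⇒≥ h) , inj₁ refl)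

        is-tile : ∀ {n v} t → Steps _→s_ n (down (toℕ t) 0) v → Sem goal v → ¬ ¬ Sem (tile t) v
        is-tile t q g ¬c with refl ← down-s q = ¬c (proj₁ g , inj₂ refl)

      start : Sem (⋀ λ t → forbid (start? t) (tile t)) (spot 0)
      start = from (⋀⇔ λ t → forbid (start? t) (tile t)) λ t →
        forbid⇐ (start? t) (tile t) λ c → subst Start (sym (tile-eq c)) starts

      tiled : ¬ Sem (ex [r*] untiled) (spot 0)
      tiled z with i , _ , u ← spot-r* {untiled} z = to (⋀⇔ (λ t → neg (tile t))) u (w i) refl

      hooked : ∀ t → ¬ Sem (ex [r*] (unhooked t)) (spot 0)
      hooked t z with i , _ , c , u ← spot-r* {unhooked t} z =
        u (_ , read , cong (λ t → down (toℕ t) 0) (sym (tile-eq c)))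

      blank : ∀ {t} → Sem (blankBad t) (spot 0) → Blank t
      blank (_ , next h , _ , (n , _ , p , q) , _ , y₁ , _ , y₂ , _ , (k , q′) , m)
        with refl , n≤ℓ ← spot-r h p with eq , refl ← spot-mark (q ++ˢ (y₁ ∷ y₂ ∷ q′)) m =
        subst (Blank ∘ w) (sym (+-comm n 1)) (blanks n short (subst (_≤ ℓ) (+-comm n 1) n≤ℓ))
        where
        -- `eq` reads n + 2 + k = N + 2.
        short : suc n < suc (suc N)
        short = subst (suc n <_) eq
          (subst (suc n <_) (sym (trans (+-suc n _) (cong suc (+-suc n k)))) (s≤s (s≤s (m≤m+n n k))))

      hor-ok : ∀ {t u} → Sem (horBad t u) (spot 0) → Hor t u
      hor-ok {t} {u} z with i , _ , c , _ , next h , d ← spot-r* {and (tile t) (ex [r] (tile u))} z =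
        subst₂ Hor (sym (tile-eq c)) (sym (tile-eq d)) (hor i h)

      ver-ok : ∀ {t u v} → Sem (verBad t u v) (spot 0) → Ver t u v
      ver-ok {t} {u} {v} z
        with i , i≤ℓ , c , (_ , next h , d) , m
             ← spot-r* {and (tile t) (and (ex [r] (tile u)) (ex [rⁿsⁿ] (mark v)))} z
        with le , refl ← rⁿsⁿ-mark {t = v} i≤ℓ m
        with refl ← tile-eq {t} c with refl ← tile-eq {u} d = ver i le

      dia-ok : ∀ {t u v} → Sem (diaBad t u v) (spot 0) → Dia t u v
      dia-ok {t} {u} {v} z
        with i , i≤ℓ , c , _ , next h , d , m
             ← spot-r* {and (tile t) (ex [r] (and (tile u) (ex [rⁿsⁿ] (mark v))))} z
        with le , refl ← rⁿsⁿ-mark {t = v} h m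
        with refl ← tile-eq {t} c with refl ← tile-eq {u} d = dia i le

-- Two-counter machines as puzzles

data Effect : Set where
  up down same : Effect

-- As `pred 0` is 0, a decrement has effect `down` whether or not its counter is zero; the zero test
-- matters only for `jump`.
act : Effect → ℕ → ℕ
act up   = suc
act down = pred
act same = id

effect : Fin 2 → Maybe Instr → Effect
effect c nothing             = same
effect c (just (inc d _))    = if does (c Fin.≟ d) then up else same
effect c (just (dec d _ _))  = if does (c Fin.≟ d) then down else same

-- The Booleans say whether counters 0 and 1 are zero; the value at nothing is junk.
jump : Maybe Instr → Bool → Bool → ℕ
jump nothing                    _  _  = 0
jump (just (inc _ j))           _  _  = j
jump (just (dec zero j k))      z₀ _  = if z₀ then k else j
jump (just (dec (suc _) j k))   _  z₁ = if z₁ then k else j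

nextBy : Maybe Instr → Config → Config
nextBy i (_ , a , b) = jump i (0 ≡ᵇ a) (0 ≡ᵇ b) , act (effect zero i) a , act (effect (suc zero) i) b

-- A total version of `step`, which can be iterated without regard to halting.
next : Program → Config → Config
next P c = nextBy (nth P (proj₁ c)) c

step-next : ∀ P c → (nth P (proj₁ c) ≡ nothing × step P c ≡ nothing) ⊎ step P c ≡ just (next P c)
step-next P (pc , a , b) with nth P pc
... | nothing                                    = inj₁ (refl , refl)
... | just (inc zero j)                          = inj₂ refl
... | just (inc (suc zero) j)                    = inj₂ refl
step-next P (pc , zero , b)  | just (dec zero j k) = inj₂ refl
step-next P (pc , suc a , b) | just (dec zero j k) = inj₂ refl
step-next P (pc , a , zero)  | just (dec (suc zero) j k) = inj₂ refl
step-next P (pc , a , suc b) | just (dec (suc zero) j k) = inj₂ refl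

step-halt : ∀ P {c} → nth P (proj₁ c) ≡ nothing → step P c ≡ nothing
step-halt P {pc , _} eq with nth P pc
step-halt P refl | nothing = refl

runN-halt : ∀ P {c} n → step P c ≡ nothing → runN P (suc n) c ≡ nothing
runN-halt P n eq rewrite eq = refl

runN-step : ∀ P {c c′} n → step P c ≡ just c′ → runN P (suc n) c ≡ runN P n c′
runN-step P n eq rewrite eq = refl

conf : Program → Config → ℕ → Config
conf P c zero    = c
conf P c (suc k) = next P (conf P c k)

conf-next : ∀ P c k → conf P (next P c) k ≡ conf P c (suc k)
conf-next P c zero    = refl
conf-next P c (suc k) = cong (next P) (conf-next P c k)

-- Up to the first halting configuration, `step` and `next` agree.
halting-conf : ∀ P n c → runN P n c ≡ nothing → ∃ λ m → nth P (proj₁ (conf P c m)) ≡ nothing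
halting-conf P (suc n) c eq with step-next P c
... | inj₁ (halted , _) = 0 , halted
... | inj₂ s with m , halted ← halting-conf P n (next P c) (trans (sym (runN-step P n s)) eq) =
  suc m , subst (λ d → nth P (proj₁ d) ≡ nothing) (conf-next P c m) halted

act≤ : ∀ e v → act e v ≤ suc v
act≤ up   v = ≤-refl
act≤ down v = ≤-trans pred[n]≤n (n≤1+n v)
act≤ same v = n≤1+n v

origin : Config
origin = 0 , 0 , 0

conf-bound : ∀ P k → proj₁ (proj₂ (conf P origin k)) ≤ k × proj₂ (proj₂ (conf P origin k)) ≤ k
conf-bound P zero    = z≤n , z≤n
conf-bound P (suc k) =
  let a≤ , b≤ = conf-bound P k
      i = nth P (proj₁ (conf P origin k))
  in ≤-trans (act≤ (effect zero i) _) (s≤s a≤) , ≤-trans (act≤ (effect (suc zero) i) _) (s≤s b≤)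

-- Cells and their local constraints.

record Cell : Set where
  constructor mkCell
  field
    state     : ℕ
    isFirst   : Bool
    at₀ at₁   : Bool
open Cell

cell : Config → ℕ → Cell
cell (pc , a , b) o = mkCell pc (o ≡ᵇ 0) (o ≡ᵇ a) (o ≡ᵇ b)

-- If y starts a row then x ends one; keeping the counter bits off x prevents overflow.
CHor : Cell → Cell → Set
CHor x y = (isFirst y ≡ false → state y ≡ state x)
         × (isFirst y ≡ true → at₀ x ≡ false × at₁ x ≡ false)

-- Here z lies below x, and y is to the right of x. For `down` the bit comes from y, or stays at
-- offset 0 if the counter is already zero. For `up` it comes from the upper left, which `DiaBit`
-- handles, except that the first cell must lose it.
VerBit : Effect → (fx ax fy ay az : Bool) → Set
VerBit up   fx ax fy ay az = fx ≡ true → az ≡ false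
VerBit down fx ax fy ay az = az ≡ (fx ∧ ax) ∨ (not fy ∧ ay)
VerBit same fx ax fy ay az = az ≡ ax

DiaBit : Effect → (ax fy az : Bool) → Set
DiaBit up   ax fy az = fy ≡ false → az ≡ ax
DiaBit down ax fy az = ⊤
DiaBit same ax fy az = ⊤

verBit? : ∀ e fx ax fy ay az → Dec (VerBit e fx ax fy ay az)
verBit? up   fx ax fy ay az = (fx Bool.≟ true) →-dec (az Bool.≟ false)
verBit? down fx ax fy ay az = az Bool.≟ _
verBit? same fx ax fy ay az = az Bool.≟ _

diaBit? : ∀ e ax fy az → Dec (DiaBit e ax fy az)
diaBit? up   ax fy az = (fy Bool.≟ false) →-dec (az Bool.≟ ax)
diaBit? down ax fy az = yes tt
diaBit? same ax fy az = yes tt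

≡ᵇ-false : ∀ {m n} → n < m → (m ≡ᵇ n) ≡ false
≡ᵇ-false {suc m} {zero}  _         = refl
≡ᵇ-false {suc m} {suc n} (s≤s n<m) = ≡ᵇ-false n<m

≡ᵇ-false⇒≢ : ∀ {m n} → (m ≡ᵇ n) ≡ false → m ≢ n
≡ᵇ-false⇒≢ {suc m} eq refl = ≡ᵇ-false⇒≢ {m} eq refl

-- What the right neighbour of the cell at offset o shows of a counter of value v:
-- at the end of the row the neighbour belongs to the next row.
Neighbour : (v o : ℕ) (fy ay : Bool) → Set
Neighbour v o fy ay = (fy ≡ false × ay ≡ (suc o ≡ᵇ v)) ⊎ (fy ≡ true × v < o)

down-bit : ∀ v o {fy ay} → Neighbour v o fy ay →
           ((o ≡ᵇ 0) ∧ (o ≡ᵇ v)) ∨ (not fy ∧ ay) ≡ (o ≡ᵇ pred v)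
down-bit zero    zero    (inj₁ (refl , refl)) = refl
down-bit (suc v) zero    (inj₁ (refl , refl)) = refl
down-bit zero    (suc o) (inj₁ (refl , refl)) = refl
down-bit (suc v) (suc o) (inj₁ (refl , refl)) = refl
-- At the row end the bit of the neighbour is masked, and v < o makes both sides false.
down-bit v       (suc o) (inj₂ (refl , v<o))  = sym (≡ᵇ-false (≤-<-trans pred[n]≤n v<o))

-- A real run obeys the constraints; `bit-first` and `bit-later` show conversely that they leave no
-- other choice.
verBit-act : ∀ e v o {fy ay} → Neighbour v o fy ay →
             VerBit e (o ≡ᵇ 0) (o ≡ᵇ v) fy ay (o ≡ᵇ act e v)
verBit-act up   v zero    n _ = refl
verBit-act up   v (suc o) n ()
verBit-act down v o       n = sym (down-bit v o n)
verBit-act same v o       n = refl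

diaBit-act : ∀ e v o → DiaBit e (o ≡ᵇ v) false (suc o ≡ᵇ act e v)
diaBit-act up   v o _ = refl
diaBit-act down v o   = tt
diaBit-act same v o   = tt

diaBit-row-end : ∀ e {ax az} → DiaBit e ax true az
diaBit-row-end up ()
diaBit-row-end down = tt
diaBit-row-end same = tt

bit-first : ∀ e v {az} → VerBit e true (0 ≡ᵇ v) false (1 ≡ᵇ v) az → az ≡ (0 ≡ᵇ act e v)
bit-first up   v h = h refl
bit-first down v h = trans h (down-bit v 0 (inj₁ (refl , refl)))
bit-first same v h = h

bit-later : ∀ e v o {fy ay az} → Neighbour v (suc o) fy ay →
            VerBit e false (suc o ≡ᵇ v) fy ay az → DiaBit e (o ≡ᵇ v) false az →
            az ≡ (suc o ≡ᵇ act e v)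
bit-later up   v o n h d = d refl
bit-later down v o n h d = trans h (down-bit v (suc o) n)
bit-later same v o n h d = h

Neighbours : Config → ℕ → Cell → Set
Neighbours (_ , a , b) o y = Neighbour a o (isFirst y) (at₀ y) × Neighbour b o (isFirst y) (at₁ y)

neighbours-inside : ∀ {c o y} → y ≡ cell c (suc o) → Neighbours c o y
neighbours-inside refl = inj₁ (refl , refl) , inj₁ (refl , refl)

neighbours-edge : ∀ {c c′ o y} → y ≡ cell c′ 0 →
                  proj₁ (proj₂ c) < o → proj₂ (proj₂ c) < o → Neighbours c o y
neighbours-edge refl a< b< = inj₂ (refl , a<) , inj₂ (refl , b<)

-- The puzzle of a program.

module Machine (P : Program) where

  -- The bits at offset 0 are the zero tests, so the jump is decided at the first cell; `CHor`
  -- copies the state along the row.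
  CVer CDia : Cell → Cell → Cell → Set
  CVer x y z = isFirst z ≡ isFirst x
             × (isFirst x ≡ true → state z ≡ jump i (at₀ x) (at₁ x))
             × VerBit (effect zero i) (isFirst x) (at₀ x) (isFirst y) (at₀ y) (at₀ z)
             × VerBit (effect (suc zero) i) (isFirst x) (at₁ x) (isFirst y) (at₁ y) (at₁ z)
    where i = nth P (state x)
  CDia x y z = DiaBit (effect zero i) (at₀ x) (isFirst y) (at₀ z)
             × DiaBit (effect (suc zero) i) (at₁ x) (isFirst y) (at₁ z)
    where i = nth P (state x)

  targets : Instr → List ℕ
  targets (inc _ j)   = j ∷ []
  targets (dec _ j k) = j ∷ k ∷ []

  -- 0 is both the start and the value of `jump` without an instruction.
  states : List ℕ
  states = 0 ∷ concatMap targets P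

  bools : List Bool
  bools = true ∷ false ∷ []

  cells : List Cell
  cells = cartesianProductWith (λ q (f , a , b) → mkCell q f a b) states
            (cartesianProduct bools (cartesianProduct bools bools))

  halted? : {A : Set} (i : Maybe A) → Dec (i ≡ nothing)
  halted? nothing  = yes refl
  halted? (just _) = no λ ()

  at : Fin (length cells) → Cell
  at = lookup cells

  puzzle : Puzzle
  puzzle = record
    { K      = length cells
    ; Start  = λ t → state (at t) ≡ 0 × isFirst (at t) ≡ true × at₀ (at t) ≡ true × at₁ (at t) ≡ true
    ; Final  = λ t → nth P (state (at t)) ≡ nothing
    ; Blank  = λ t → isFirst (at t) ≡ false × at₀ (at t) ≡ false × at₁ (at t) ≡ false
    ; Hor    = λ t u → CHor (at t) (at u)
    ; Ver    = λ t u v → CVer (at t) (at u) (at v)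
    ; Dia    = λ t u v → CDia (at t) (at u) (at v)
    ; start? = λ t → (_ ≟ _) ×-dec (_ Bool.≟ _) ×-dec (_ Bool.≟ _) ×-dec (_ Bool.≟ _)
    ; final? = λ t → halted? _
    ; blank? = λ t → (_ Bool.≟ _) ×-dec (_ Bool.≟ _) ×-dec (_ Bool.≟ _)
    ; hor?   = λ t u → ((_ Bool.≟ _) →-dec (_ ≟ _))
                 ×-dec ((_ Bool.≟ _) →-dec ((_ Bool.≟ _) ×-dec (_ Bool.≟ _)))
    ; ver?   = λ t u v → (_ Bool.≟ _) ×-dec ((_ Bool.≟ _) →-dec (_ ≟ _))
                 ×-dec verBit? (effect zero (nth P (state (at t)))) _ _ _ _ _
                 ×-dec verBit? (effect (suc zero) (nth P (state (at t)))) _ _ _ _ _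
    ; dia?   = λ t u v → diaBit? (effect zero (nth P (state (at t)))) _ _ _
                 ×-dec diaBit? (effect (suc zero) (nth P (state (at t)))) _ _ _
    }

  record Tableau (N ℓ : ℕ) (x : ℕ → Cell) : Set where
    field
      starts : x 0 ≡ cell origin 0
      ends   : nth P (state (x ℓ)) ≡ nothing
      blanks : ∀ i → suc i < suc (suc N) → suc i ≤ ℓ →
               isFirst (x (suc i)) ≡ false × at₀ (x (suc i)) ≡ false × at₁ (x (suc i)) ≡ false
      hor    : ∀ i → suc i ≤ ℓ → CHor (x i) (x (suc i))
      ver    : ∀ i → i + suc (suc N) ≤ ℓ → CVer (x i) (x (suc i)) (x (i + suc (suc N)))
      dia    : ∀ i → suc i + suc (suc N) ≤ ℓ → CDia (x i) (x (suc i)) (x (suc i + suc (suc N)))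

  ver-first : ∀ {c x y z} → x ≡ cell c 0 → y ≡ cell c 1 → CVer x y z → z ≡ cell (next P c) 0
  ver-first {pc , a , b} refl refl (refl , q , v₀ , v₁)
    with refl ← q refl
    with refl ← bit-first (effect zero (nth P pc)) a v₀
    with refl ← bit-first (effect (suc zero) (nth P pc)) b v₁ = refl

  -- The cells x, y, y′ are consecutive, and z′, z lie below x, y. The state of z comes from z′, its
  -- bits from the cells above.
  ver-later : ∀ {c o x y y′ z′ z} → x ≡ cell c o → y ≡ cell c (suc o) →
              Neighbours c (suc o) y′ →
              z′ ≡ cell (next P c) o → CHor z′ z → CVer y y′ z → CDia x y z →
              z ≡ cell (next P c) (suc o)
  ver-later {pc , a , b} {o} refl refl (n₀ , n₁) refl (same-state , _) (refl , _ , v₀ , v₁) (d₀ , d₁)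
    with refl ← same-state refl
    with refl ← bit-later (effect zero (nth P pc)) a o n₀ v₀ d₀
    with refl ← bit-later (effect (suc zero) (nth P pc)) b o n₁ v₁ d₁ = refl

  hor-last : ∀ {c@(_ , a , b) : Config} {c′ o x y} → x ≡ cell c o → y ≡ cell c′ 0 → CHor x y →
             (o ≡ᵇ a) ≡ false × (o ≡ᵇ b) ≡ false
  hor-last refl refl (_ , no-overflow) = no-overflow refl

  -- From a tableau to a halting run.

  module Sound {N ℓ : ℕ} {x : ℕ → Cell} (tab : Tableau N ℓ x) where
    open Tableau tab

    W : ℕ
    W = suc (suc N)

    -- The word may break off within a row, so cells are only claimed up to ℓ.
    record Row (p : ℕ) (c : Config) : Set where
      constructor row
      field
        row-cell : ∀ o → o < W → o + p ≤ ℓ → x (o + p) ≡ cell c o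
        bound₀   : proj₁ (proj₂ c) < W
        bound₁   : proj₂ (proj₂ c) < W

    row-origin : Row 0 origin
    row-origin = row row-cell z<s z<s
      where
      row-cell : ∀ o → o < W → o + 0 ≤ ℓ → x (o + 0) ≡ cell origin o
      row-cell zero    _   _ = starts
      row-cell (suc o) o<W h with x (suc o + 0) | blanks (o + 0) (subst (_< W) (sym (+-identityʳ _)) o<W) h
                                | x (o + 0) | row-cell o (<⇒≤ o<W) (<⇒≤ h) | hor (o + 0) h
      ... | _ | refl , refl , refl | _ | refl | same-state , _ with same-state refl
      ...   | refl = refl

    -- The first cell below starts a new row. Hence the cell before it ends the old one and carries
    -- no bit, which bounds the counters; the other cells follow from left to right.
    row-next : ∀ p c → p + W ≤ ℓ → Row p c → Row (p + W) (next P c)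
    row-next p c@(pc , a , b) h (row row-cell a<W b<W) =
      row later (≤-<-trans (act≤ (effect zero i) a) (in-row a<W (proj₁ last-bits)))
                (≤-<-trans (act≤ (effect (suc zero) i) b) (in-row b<W (proj₂ last-bits)))
      where
      i = nth P pc

      inside : ∀ o → o < W → o + p ≤ ℓ
      inside o o<W = ≤-trans (<⇒≤ (subst (_< p + W) (+-comm p o) (+-monoʳ-< p o<W))) h

      first : x (p + W) ≡ cell (next P c) 0
      first = ver-first {c} (row-cell 0 z<s (inside 0 z<s)) (row-cell 1 (s≤s z<s) (inside 1 (s≤s z<s))) (ver p h)

      last-bits : (suc N ≡ᵇ a) ≡ false × (suc N ≡ᵇ b) ≡ false
      last-bits = hor-last {c} {next P c} {suc N} (row-cell (suc N) ≤-refl (inside (suc N) ≤-refl))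
                           (trans (cong x (+-comm W p)) first)
                           (hor (suc N + p) (subst (_≤ ℓ) (+-comm p W) h))

      in-row : ∀ {v} → v < W → (suc N ≡ᵇ v) ≡ false → suc v < W
      in-row (s≤s v≤N) eq = s≤s (≤∧≢⇒< v≤N (≡ᵇ-false⇒≢ eq ∘ sym))

      neighbours : ∀ o → suc o < W → Neighbours c (suc o) (x (suc (suc o) + p))
      neighbours o o<W with m≤n⇒m<n∨m≡n o<W
      ... | inj₁ o+2<W = neighbours-inside {c} (row-cell (suc (suc o)) o+2<W (inside _ o+2<W))
      ... | inj₂ refl  = neighbours-edge {c} {next P c} (trans (cong x (+-comm W p)) first)
                           (≤-pred (in-row a<W (proj₁ last-bits))) (≤-pred (in-row b<W (proj₂ last-bits)))

      later : ∀ o → o < W → o + (p + W) ≤ ℓ → x (o + (p + W)) ≡ cell (next P c) o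
      later zero    _   _  = first
      later (suc o) o<W h′ =
        ver-later {c} {y′ = x (suc (suc o) + p)} (row-cell o (<⇒≤ o<W) (inside o (<⇒≤ o<W))) (row-cell (suc o) o<W (inside (suc o) o<W))
          (neighbours o o<W) (later o (<⇒≤ o<W) (<⇒≤ h′)) (hor (o + (p + W)) h′)
          (subst (λ n → CVer (x (suc o + p)) (x (suc (suc o) + p)) (x n)) (+-assoc (suc o) p W)
            (ver (suc o + p) (subst (_≤ ℓ) (sym (+-assoc (suc o) p W)) h′)))
          (subst (λ n → CDia (x (o + p)) (x (suc o + p)) (x n)) (+-assoc (suc o) p W)
            (dia (o + p) (subst (_≤ ℓ) (sym (+-assoc (suc o) p W)) h′)))

    -- If no further full stride fits, position ℓ lies in the current row, so its halting state is
    -- that of c. Otherwise a row costs one step of the run and at least one unit of fuel is left.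
    run-halts : ∀ fuel p c → p ≤ ℓ → ℓ ≤ p + fuel → Row p c → runN P (suc fuel) c ≡ nothing
    run-halts fuel p c p≤ℓ enough r with p + W ≤? ℓ
    ... | no h = runN-halt P fuel (step-halt P (subst (λ y → nth P (state y) ≡ nothing) eq ends))
      where
      eq : x ℓ ≡ cell c (ℓ ∸ p)
      eq = trans (cong x (sym (m∸n+n≡m p≤ℓ)))
             (Row.row-cell r (ℓ ∸ p)
               (+-cancelʳ-< p _ _ (subst₂ _<_ (sym (m∸n+n≡m p≤ℓ)) (+-comm p W) (≰⇒> h)))
               (≤-reflexive (m∸n+n≡m p≤ℓ)))
    run-halts zero p c p≤ℓ enough r | yes h =
      contradiction (≤-trans h enough) (<⇒≱ (subst (_< p + W) (sym (+-identityʳ p)) (m<m+n p z<s)))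
    run-halts (suc fuel) p c p≤ℓ enough r | yes h with step-next P c
    ... | inj₁ (_ , s) = runN-halt P (suc fuel) s
    ... | inj₂ s = trans (runN-step P (suc fuel) s)
      (run-halts fuel (p + W) (next P c) h
        (≤-trans enough (subst (_≤ p + W + fuel) (sym (+-suc p fuel)) 
          (+-monoˡ-≤ fuel (m<m+n p z<s))))
        (row-next p c h r))

    halts : runN P (suc ℓ) origin ≡ nothing
    halts = run-halts ℓ 0 origin z≤n ≤-refl row-origin

  tableau : ∀ {N ℓ w} → Solution puzzle (suc (suc N)) ℓ w → Tableau N ℓ (at ∘ w)
  tableau sol = record { Solution sol ; starts = origin-cell (Solution.starts sol) }
    where
    origin-cell : ∀ {x} → state x ≡ 0 × isFirst x ≡ true × at₀ x ≡ true × at₁ x ≡ true → x ≡ cell origin 0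
    origin-cell (refl , refl , refl , refl) = refl

  -- From a halting run to a tableau.

  module Complete (m : ℕ) (halted : nth P (proj₁ (conf P origin m)) ≡ nothing) where

    -- Counters stay at most m up to row m, so offset m + 1 is always free. The word ends on the
    -- first cell of row m, which has halted.
    W ℓ : ℕ
    W = suc (suc m)
    ℓ = m * W

    c : ℕ → Config
    c = conf P origin

    x : ℕ → Cell
    x i = cell (c (i / W)) (i % W)

    x-at : ∀ k {o} → o < W → x (o + k * W) ≡ cell (c k) o
    x-at k {o} o<W = cong₂ (λ q r → cell (c q) r)
      (trans (+-distrib-/-∣ʳ o (divides-refl k)) (cong₂ _+_ (m<n⇒m/n≡0 o<W) (m*n/n≡m k W)))
      (trans ([m+kn]%n≡m%n o k W) (m<n⇒m%n≡m o<W))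

    by-rows : (T : ℕ → Set) → (∀ k o → o < W → T (o + k * W)) → ∀ i → T i
    by-rows T h i = subst T (sym (m≡m%n+[m/n]*n i W)) (h (i / W) (i % W) (m%n<n i W))

    rows< : ∀ {k} o → o + k * W + W ≤ ℓ → k < m
    rows< {k} o h = *-cancelʳ-≤ (suc k) m W
      (≤-trans (subst (W + k * W ≤_) (+-comm W (o + k * W)) (+-monoʳ-≤ W (m≤n+m (k * W) o))) h)

    edge : ∀ {o} → o < W → suc o < W ⊎ o ≡ suc m
    edge (s≤s o≤) with m≤n⇒m<n∨m≡n o≤
    ... | inj₁ o<   = inj₁ (s≤s o<)
    ... | inj₂ refl = inj₂ refl

    x-below : ∀ k {o} → o < W → x (o + k * W + W) ≡ cell (next P (c k)) o
    x-below k {o} o<W =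
      trans (cong x (trans (+-assoc o (k * W) W) (cong (o +_) (+-comm (k * W) W)))) (x-at (suc k) o<W)

    hor-same : ∀ {x y} c o → x ≡ cell c o → y ≡ cell c (suc o) → CHor x y
    hor-same c o refl refl = (λ _ → refl) , λ ()

    hor-edge : ∀ {x y} c c′ o → x ≡ cell c o → y ≡ cell c′ 0 →
               proj₁ (proj₂ c) < o → proj₂ (proj₂ c) < o → CHor x y
    hor-edge c c′ o refl refl a< b< = (λ ()) , λ _ → ≡ᵇ-false a< , ≡ᵇ-false b<

    ver-ok : ∀ {x y z} c o → x ≡ cell c o → z ≡ cell (next P c) o →
             Neighbours c o y → CVer x y z
    ver-ok c@(pc , a , b) o refl refl (n₀ , n₁) =
      refl , jumps o , verBit-act (effect zero i) a o n₀ , verBit-act (effect (suc zero) i) b o n₁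
      where
      i = nth P pc
      jumps : ∀ o → (o ≡ᵇ 0) ≡ true → proj₁ (next P c) ≡ jump i (o ≡ᵇ a) (o ≡ᵇ b)
      jumps zero _ = refl

    dia-same : ∀ {x y z} c o → x ≡ cell c o → y ≡ cell c (suc o) → z ≡ cell (next P c) (suc o) → CDia x y z
    dia-same (pc , a , b) o refl refl refl =
      diaBit-act (effect zero i) a o , diaBit-act (effect (suc zero) i) b o
      where i = nth P pc

    dia-edge : ∀ {x y z} c → y ≡ cell c 0 → CDia x y z
    dia-edge {x} c refl = diaBit-row-end (effect zero i) , diaBit-row-end (effect (suc zero) i)
      where i = nth P (state x)

    bounds : ∀ {k} → k ≤ m → proj₁ (proj₂ (c k)) < suc m × proj₂ (proj₂ (c k)) < suc m
    bounds k≤m = let a≤ , b≤ = conf-bound P _ in s≤s (≤-trans a≤ k≤m) , s≤s (≤-trans b≤ k≤m)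

    hor-x : ∀ k o → o < W → suc (o + k * W) ≤ ℓ → CHor (x (o + k * W)) (x (suc (o + k * W)))
    hor-x k o o<W h with edge o<W
    ... | inj₁ o+1<W = hor-same (c k) o (x-at k o<W) (x-at k o+1<W)
    ... | inj₂ refl  =
      let a< , b< = bounds (<⇒≤ (*-cancelʳ-≤ (suc k) m W h))
      in hor-edge (c k) (c (suc k)) o (x-at k o<W) (x-at (suc k) z<s) a< b<

    neighbours : ∀ k o → o < W → k ≤ m → Neighbours (c k) o (x (suc (o + k * W)))
    neighbours k o o<W k≤m with edge o<W
    ... | inj₁ o+1<W = neighbours-inside {c k} (x-at k o+1<W)
    ... | inj₂ refl  =
      let a< , b< = bounds k≤m in neighbours-edge {c k} {c (suc k)} (x-at (suc k) z<s) a< b<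

    ver-x : ∀ k o → o < W → o + k * W + W ≤ ℓ →
            CVer (x (o + k * W)) (x (suc (o + k * W))) (x (o + k * W + W))
    ver-x k o o<W h =
      ver-ok {y = x (suc (o + k * W))} (c k) o (x-at k o<W) (x-below k o<W) (neighbours k o o<W (<⇒≤ (rows< o h)))

    dia-x : ∀ k o → o < W → suc (o + k * W) + W ≤ ℓ →
            CDia (x (o + k * W)) (x (suc (o + k * W))) (x (suc (o + k * W) + W))
    dia-x k o o<W h with edge o<W
    ... | inj₁ o+1<W = dia-same (c k) o (x-at k o<W) (x-at k o+1<W) (x-below k o+1<W)
    ... | inj₂ refl  = dia-edge {x (o + k * W)} {z = x (suc (o + k * W) + W)} (c (suc k)) (x-at (suc k) z<s)

    blank-x : ∀ {x} i → x ≡ cell origin (suc i) → isFirst x ≡ false × at₀ x ≡ false × at₁ x ≡ false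
    blank-x i refl = refl , refl , refl

    complete : Tableau m ℓ x
    complete = record
      { starts = x-at 0 z<s
      ; ends   = subst (λ y → nth P (state y) ≡ nothing) (sym (x-at m z<s)) halted
      ; blanks = λ i i<W _ → blank-x i (trans (cong x (sym (+-identityʳ (suc i)))) (x-at 0 i<W))
      ; hor    = by-rows _ hor-x
      ; ver    = by-rows _ ver-x
      ; dia    = by-rows _ dia-x
      }

  -- From cells to tiles.

  nth-∈ : ∀ {A : Program} n {i} → nth A n ≡ just i → i ∈ A
  nth-∈ {j ∷ A} zero    refl = here refl
  nth-∈ {j ∷ A} (suc n) eq   = there (nth-∈ n eq)

  jump-∈ : ∀ i z₀ z₁ → jump (just i) z₀ z₁ ∈ targets i
  jump-∈ (inc c j)            z₀    z₁    = here refl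
  jump-∈ (dec zero j k)       true  z₁    = there (here refl)
  jump-∈ (dec zero j k)       false z₁    = here refl
  jump-∈ (dec (suc c) j k)    z₀    true  = there (here refl)
  jump-∈ (dec (suc c) j k)    z₀    false = here refl

  state-∈ : ∀ k → proj₁ (conf P origin k) ∈ states
  state-∈ zero    = here refl
  state-∈ (suc k) = at-jump (nth P (proj₁ (conf P origin k))) refl
    where
    at-jump : ∀ i → nth P (proj₁ (conf P origin k)) ≡ i → ∀ {z₀ z₁} → jump i z₀ z₁ ∈ states
    at-jump nothing  eq = here refl
    at-jump (just i) eq =
      there (∈-concatMap⁺ targets {xs = P}
        (Any.map (λ { refl → jump-∈ i _ _ }) (nth-∈ (proj₁ (conf P origin k)) eq)))

  bool-∈ : ∀ b → b ∈ bools
  bool-∈ true  = here refl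
  bool-∈ false = there (here refl)

  cell-∈ : ∀ k o → cell (conf P origin k) o ∈ cells
  cell-∈ k o = ∈-cartesianProductWith⁺ _ (state-∈ k)
    (∈-cartesianProduct⁺ (bool-∈ _) (∈-cartesianProduct⁺ (bool-∈ _) (bool-∈ _)))

  solution : ∀ {N ℓ x} → (∀ i → x i ∈ cells) → Tableau N ℓ x → ∃ (Solution puzzle (suc (suc N)) ℓ)
  solution {N} {ℓ} {x} x∈ tab = w , record
    { starts = starts-at (trans (sym (x≡ 0)) starts)
    ; ends   = subst (λ y → nth P (state y) ≡ nothing) (x≡ ℓ) ends
    ; blanks = λ i i<W h →
        subst (λ y → isFirst y ≡ false × at₀ y ≡ false × at₁ y ≡ false) (x≡ (suc i)) (blanks i i<W h)
    ; hor    = λ i h → subst₂ CHor (x≡ i) (x≡ (suc i)) (hor i h)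
    ; ver    = λ i h → subst₃ CVer (x≡ i) (x≡ (suc i)) (x≡ _) (ver i h)
    ; dia    = λ i h → subst₃ CDia (x≡ i) (x≡ (suc i)) (x≡ _) (dia i h)
    }
    where
    open Tableau tab

    w : ℕ → Fin (length cells)
    w i = index (x∈ i)

    x≡ : ∀ i → x i ≡ at (w i)
    x≡ i = lookup-index (x∈ i)

    subst₃ : ∀ (C : Cell → Cell → Cell → Set) {x x′ y y′ z z′} → x ≡ x′ → y ≡ y′ → z ≡ z′ →
             C x y z → C x′ y′ z′
    subst₃ C refl refl refl h = h

    starts-at : ∀ {y} → y ≡ cell origin 0 → state y ≡ 0 × isFirst y ≡ true × at₀ y ≡ true × at₁ y ≡ true
    starts-at refl = refl , refl , refl , refl

  solvable : Halts P → ∃ λ N → ∃ λ ℓ → ∃ (Solution puzzle (suc (suc N)) ℓ)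
  solvable (n , halts) =
    let m , halted = halting-conf P n origin halts
    in m , _ , solution (λ i → cell-∈ (i / suc (suc m)) (i % suc (suc m))) (Complete.complete m halted)

  halting : ∀ ℓ → ¬ ¬ runN P (suc ℓ) origin ≡ nothing → Halts P
  halting ℓ ¬¬h = suc ℓ , decidable-stable (halted? _) ¬¬h

-- The reduction.

concept : Program → Concept Basic
concept P = Encoding.concept (Machine.puzzle P)

halts⇔sem : ∀ r s P → Halts P ⇔ Σ Interp λ I → ∃ λ d → Semantics.Sem r s I (concept P) d
halts⇔sem r s P = mk⇔
  (λ h → let N , ℓ , w , sol = solvable h
         in Model.model puzzle N ℓ w , _ , Model.complete puzzle N ℓ w r s sol)
  (λ (I , _ , c) → let N , ℓ , ¬¬sol = Encoding.sound puzzle r s I c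
                   in halting ℓ (¬¬-map (λ (w , sol) → Sound.halts (tableau sol)) ¬¬sol))
  where open Machine P

undecidable : ∀ {a ℓ} {X : Set a} {S : X → Set ℓ} (g : Program → X) →
              (∀ P → Halts P ⇔ S (g P)) → Undecidable S
undecidable g red (f , decides) = f ∘ g , λ P → decides (g P) ⇔-∘ red P

sat-undecidable : ∀ {Lang} (⟦_⟧L : Lang → Word → Set) r s (lang : Basic → Lang) →
                  (∀ b w → ⟦ lang b ⟧L w ⇔ ⟦_⟧R r s (basic b) w) → Undecidable (Satisfiable ⟦_⟧L)
sat-undecidable ⟦_⟧L r s lang spec = undecidable (mapConcept lang ∘ concept) λ P →
  ⇔-sym (Transfer.sat⇔ ⟦_⟧L r s lang spec (concept P)) ⇔-∘ halts⇔sem r s P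

theorem4p15 : Undecidable SatVPL × ((r s : ℕ) → Undecidable (SatR r s))
-- The automata are built for `call 0` and `ret 0`; the fixed languages meet the specification by
-- definition.
theorem4p15 = sat-undecidable Accepts 0 0 vpa vpa-spec
            , λ r s → sat-undecidable (⟦_⟧R r s) r s basic (λ b w → mk⇔ id id)
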